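{- Let $p$ be an odd prime and suppose that $x,y,z$ are positive integers with $|x-y|=1$ and $$p^x+(2p+1)^y=z^2.$$ Then exactly one of the following holds. (i) $(x,y,z)=(2,1,p+1)$. (ii) The integer $2p+1$ is composite, and there exist integers $k\ge 2$, $a\ge 1$ and $b\ge 0$ with $x=2a$ and $y=2b+1$ such that $p=2k^2-1$, $2p+1=(2k-1)(2k+1)$ with $\gcd(2k-1,2k+1)=1$, $$(2k+1)^{2b+1}-(2k-1)^{2b+1}=2(2k^2-1)^a,$$ and $(2b+1)2^b<2k^2-1$; consequently $b<\lceil \log_2(2k^2-1)\rceil$. -}

module Defs where

open import Data.Nat using (ℕ; _+_; _∸_; _*_; _^_; _≤_; _<_)
open import Data.Nat.GCD using (gcd)
open import Data.Nat.Logarithm using (⌈log₂_⌉)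
open import Data.Nat.Primality using (Composite)
open import Data.Product using (_×_; ∃-syntax)
open import Data.Sum using (_⊎_)
open import Relation.Binary.PropositionalEquality using (_≡_)
open import Relation.Nullary using (¬_)

ExactlyOneOf : Set → Set → Set
ExactlyOneOf A B = (A ⊎ B) × ¬ (A × B)

CaseI : (p x y z : ℕ) → Set
CaseI p x y z = x ≡ 2 × y ≡ 1 × z ≡ p + 1

-- For k ≥ 2 every ∸ below agrees with integer subtraction, since its
-- right argument is at most its left one.
CaseII : (p x y : ℕ) → Set
CaseII p x y =
  Composite (2 * p + 1) ×
  (∃[ k ] ∃[ a ] ∃[ b ]
    ( 2 ≤ k × 1 ≤ a × 0 ≤ b
    × x ≡ 2 * a
    × y ≡ 2 * b + 1
    × p ≡ 2 * k ^ 2 ∸ 1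
    × 2 * p + 1 ≡ (2 * k ∸ 1) * (2 * k + 1)
    × gcd (2 * k ∸ 1) (2 * k + 1) ≡ 1
    × (2 * k + 1) ^ (2 * b + 1) ∸ (2 * k ∸ 1) ^ (2 * b + 1)
        ≡ 2 * (2 * k ^ 2 ∸ 1) ^ a
    × (2 * b + 1) * 2 ^ b < 2 * k ^ 2 ∸ 1
    × b < ⌈log₂ (2 * k ^ 2 ∸ 1) ⌉
    ))

{-# OPTIONS --safe #-}

-- Write q = 2p+1; the parities of x and y differ, so one of the two powers is
-- a perfect square w², and z² − w² = (z − w)(z + w) splits the other power nʸ
-- into coprime factors, hence into y-th powers: rs = n and sʸ = rʸ + 2w.
--
-- If x is odd, then n = p gives r = 1, so pˣ = 1 + 2qᵐ ≡ 3 (mod p), p = 3, and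
-- 3ˣ ≡ 1 (mod 7) contradicts that x is odd.
--
-- If x = 2a and y = 2b+1, then rs = q with r, s odd, s = r + 2e, and
-- e · (sʸ − rʸ)/(s − r) = pᵃ, where AM–GM bounds the quotient below by
-- (2b+1)qᵇ ≥ (2b+1)2ᵇpᵇ.  As a ≤ b+1, either p ∣ e, which forces b = 0 and
-- the first case, or e = 1, which gives the second one.
module Submission where

open import Defs
open import Data.Nat using (ℕ; zero; suc; _+_; _∸_; _*_; _^_; _≤_; _<_; _%_; ∣_-_∣; z≤n; s≤s; z<s; s<s⁻¹; NonZero; ≢-nonZero; _/_; >-nonZero; >-nonZero⁻¹)
open import Data.Nat.Coprimality using (Coprime; coprime-divisor; coprime-/gcd; coprime⇒gcd≡1) renaming (sym to coprime-sym)
open import Data.Nat.Divisibility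
open import Data.Nat.DivMod using (m/n*n≡m; %-distribˡ-*; [m+kn]%n≡m%n)
open import Data.Nat.GCD using (gcd; gcd[m,n]∣m; gcd[m,n]∣n; gcd[m,n]≢0; c*gcd[m,n]≡gcd[cm,cn])
open import Data.Nat.Logarithm using (⌈log₂_⌉; ⌈log₂⌉-mono-≤; ⌈log₂2^n⌉≡n)
open import Data.Nat.Primality using (Prime; ¬prime[0]; ¬prime[1]; prime⇒nonZero; prime⇒irreducible; irreducible[2]; composite)
open import Data.Nat.Properties
open import Data.Nat.Tactic.RingSolver using (solve-∀)
open import Data.Product using (_×_; _,_; ∃-syntax)
open import Data.Sum using (_⊎_; inj₁; inj₂)
open import Relation.Binary.Definitions using (tri<; tri≈; tri>)
open import Relation.Binary.PropositionalEquality using (_≡_; refl; sym; trans; cong; cong₂; subst; subst₂; module ≡-Reasoning)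
open import Relation.Nullary using (¬_; yes; no; contradiction)

-- Parity

even⊎odd : ∀ n → (∃[ k ] n ≡ k * 2) ⊎ (∃[ k ] n ≡ 1 + k * 2)
even⊎odd zero = inj₁ (0 , refl)
even⊎odd (suc n) with even⊎odd n
... | inj₁ (k , refl) = inj₂ (k , refl)
... | inj₂ (k , refl) = inj₁ (suc k , refl)

2∤1+n*2 : ∀ n → ¬ 2 ∣ 1 + n * 2
2∤1+n*2 n (divides k eq) =
  even≢odd k n (trans (*-comm 2 k) (trans (sym eq) (cong suc (*-comm n 2))))

∣odd⇒odd : ∀ {d n} → d ∣ 1 + n * 2 → ∃[ k ] d ≡ 1 + k * 2
∣odd⇒odd {d} {n} d∣ with even⊎odd d
... | inj₁ (k , refl) = contradiction (∣-trans (n∣m*n k) d∣) (2∤1+n*2 n)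
... | inj₂ odd = odd

-- Lowering both numbers by two keeps the difference. The bound `a ≤ suc b` is `x ≤ y + 1` halved;
-- it later gives `p ^ a ≤ p ^ suc b`.
consecutive-parities : ∀ x y → ∣ x - y ∣ ≡ 1 →
  (∃[ a ] ∃[ b ] (x ≡ a * 2 × y ≡ 1 + b * 2 × a ≤ suc b)) ⊎
  (∃[ a ] ∃[ b ] (x ≡ 1 + a * 2 × y ≡ b * 2))
consecutive-parities zero (suc zero) refl = inj₁ (0 , 0 , refl , refl , z≤n)
consecutive-parities (suc zero) zero refl = inj₂ (0 , 0 , refl , refl)
consecutive-parities (suc zero) (suc (suc zero)) refl = inj₂ (0 , 1 , refl , refl)
consecutive-parities (suc (suc zero)) (suc zero) refl = inj₁ (1 , 0 , refl , refl , s≤s z≤n)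
consecutive-parities (suc (suc x)) (suc (suc y)) h with consecutive-parities x y h
... | inj₁ (a , b , refl , refl , a≤) = inj₁ (suc a , suc b , refl , refl , s≤s a≤)
... | inj₂ (a , b , refl , refl) = inj₂ (suc a , suc b , refl , refl)

-- Powers

^-distribʳ-* : ∀ m n k → (m * n) ^ k ≡ m ^ k * n ^ k
^-distribʳ-* m n zero = refl
^-distribʳ-* m n (suc k) = trans (cong (m * n *_) (^-distribʳ-* m n k))
                                 ([m*n]*[o*p]≡[m*o]*[n*p] m n (m ^ k) (n ^ k))

^-injectiveˡ : ∀ {m n} k .{{_ : NonZero k}} → m ^ k ≡ n ^ k → m ≡ n
^-injectiveˡ {m} {n} k eq with <-cmp m n
... | tri< m<n _ _ = contradiction eq (<⇒≢ (^-monoˡ-< k m<n))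
... | tri≈ _ m≡n _ = m≡n
... | tri> _ _ n<m = contradiction (sym eq) (<⇒≢ (^-monoˡ-< k n<m))

^-*2 : ∀ m k → m ^ (k * 2) ≡ (m ^ k) ^ 2
^-*2 m k = sym (^-*-assoc m k 2)

-- Coprime factors of perfect powers

coprime-* : ∀ {k m n} → Coprime k m → Coprime k n → Coprime k (m * n)
coprime-* c₁ c₂ (d∣k , d∣mn) =
  c₂ (d∣k , coprime-divisor (λ (i , j) → c₁ (∣-trans i d∣k , j)) d∣mn)

coprime-^ʳ : ∀ {m n} k → Coprime m n → Coprime m (n ^ k)
coprime-^ʳ zero c (_ , d∣1) = ∣1⇒≡1 d∣1
coprime-^ʳ (suc k) c = coprime-* c (coprime-^ʳ k c)

coprime-^ˡ : ∀ {m n} k → Coprime m n → Coprime (m ^ k) n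
coprime-^ˡ k c = coprime-sym (coprime-^ʳ k (coprime-sym c))

-- Dividing `m` and `n` by their gcd leaves coprime cofactors, whose powers stay coprime, so only
-- the `k`-th power of the gcd is common.
gcd-^ : ∀ m n k .{{_ : NonZero n}} → gcd (m ^ k) (n ^ k) ≡ gcd m n ^ k
gcd-^ m n@(suc _) k = begin
  gcd (m ^ k) (n ^ k)                     ≡⟨ cong₂ gcd (split m (gcd[m,n]∣m m n)) (split n (gcd[m,n]∣n m n)) ⟩
  gcd (g ^ k * m′ ^ k) (g ^ k * n′ ^ k)   ≡⟨ c*gcd[m,n]≡gcd[cm,cn] (g ^ k) (m′ ^ k) (n′ ^ k) ⟨
  g ^ k * gcd (m′ ^ k) (n′ ^ k)           ≡⟨ cong (g ^ k *_) (coprime⇒gcd≡1 (coprime-^ˡ k (coprime-^ʳ k (coprime-/gcd m n)))) ⟩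
  g ^ k * 1                               ≡⟨ *-identityʳ (g ^ k) ⟩
  g ^ k                                   ∎
  where
  open ≡-Reasoning
  g = gcd m n
  instance
    g≢0 : NonZero g
    g≢0 = ≢-nonZero (gcd[m,n]≢0 m n (inj₂ λ ()))
  m′ = m / g
  n′ = n / g
  split : ∀ i → g ∣ i → i ^ k ≡ g ^ k * (i / g) ^ k
  split i g∣i = trans (cong (_^ k) (trans (sym (m/n*n≡m g∣i)) (*-comm (i / g) g)))
                      (^-distribʳ-* g (i / g) k)

-- gcd(u, n)ᵏ = gcd(uᵏ, uv) = u · gcd(uᵏ⁻¹, v) = u.
coprime-factor-of-power : ∀ {u v n} k .{{_ : NonZero k}} .{{_ : NonZero n}} →
  Coprime u v → u * v ≡ n ^ k → u ≡ gcd u n ^ k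
coprime-factor-of-power {u} {v} {n} k@(suc j) c eq = begin
  u                     ≡⟨ *-identityʳ u ⟨
  u * 1                 ≡⟨ cong (u *_) (coprime⇒gcd≡1 (coprime-^ˡ j c)) ⟨
  u * gcd (u ^ j) v     ≡⟨ c*gcd[m,n]≡gcd[cm,cn] u (u ^ j) v ⟩
  gcd (u ^ k) (u * v)   ≡⟨ cong (gcd (u ^ k)) eq ⟩
  gcd (u ^ k) (n ^ k)   ≡⟨ gcd-^ u n k ⟩
  gcd u n ^ k           ∎
  where open ≡-Reasoning

-- The bases are the gcds of `u` and `v` with `n`; their product is `n` because `k`-th powers
-- determine their bases.
coprime-factors-of-power : ∀ {u v n} k .{{_ : NonZero k}} .{{_ : NonZero n}} →
  Coprime u v → u * v ≡ n ^ k → ∃[ r ] ∃[ s ] (r * s ≡ n × u ≡ r ^ k × v ≡ s ^ k)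
coprime-factors-of-power {u} {v} {n} k c eq = r , s , ^-injectiveˡ k rsᵏ≡nᵏ , u≡rᵏ , v≡sᵏ
  where
  r = gcd u n
  s = gcd v n
  u≡rᵏ = coprime-factor-of-power k c eq
  v≡sᵏ = coprime-factor-of-power k (coprime-sym c) (trans (*-comm v u) eq)
  rsᵏ≡nᵏ : (r * s) ^ k ≡ n ^ k
  rsᵏ≡nᵏ = trans (^-distribʳ-* r s k) (trans (sym (cong₂ _*_ u≡rᵏ v≡sᵏ)) eq)

-- With `u = z - w` the equation becomes `n ^ k = u * (u + 2 * w)`. A common divisor of the two
-- factors divides both `n ^ k` and `2 * w`, so the factors are coprime and each is a `k`-th power.
power-as-difference-of-squares : ∀ {w n z} k .{{_ : NonZero k}} .{{_ : NonZero n}} .{{_ : NonZero w}} →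
  Coprime n (2 * w) → w ^ 2 + n ^ k ≡ z ^ 2 →
  ∃[ r ] ∃[ s ] (r * s ≡ n × r < s × z ≡ w + r ^ k × s ^ k ≡ r ^ k + 2 * w)
power-as-difference-of-squares {w} {n} {z} k c eq with ≤-<-connex w z
... | inj₂ z<w = contradiction (sym eq)
  (<⇒≢ (<-≤-trans (^-monoˡ-< 2 z<w) (m≤m+n (w ^ 2) (n ^ k))))
... | inj₁ w≤z with m≤n⇒∃[o]m+o≡n w≤z
... | u , refl with coprime-factors-of-power k coprime uv≡nᵏ
  where
  uv≡nᵏ : u * (u + 2 * w) ≡ n ^ k
  uv≡nᵏ = +-cancelˡ-≡ (w ^ 2) _ _ (trans (expand w u) (sym eq))
    where
    expand : ∀ w u → w * (w * 1) + u * (u + 2 * w) ≡ (w + u) * ((w + u) * 1)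
    expand = solve-∀
  coprime : Coprime u (u + 2 * w)
  coprime (d∣u , d∣v) = coprime-^ˡ k c
    (subst (_ ∣_) uv≡nᵏ (∣m⇒∣m*n _ d∣u) , ∣m+n∣m⇒∣n d∣v d∣u)
... | r , s , rs≡n , refl , v≡sᵏ = r , s , rs≡n , r<s , refl , sym v≡sᵏ
  where
  r<s : r < s
  r<s = ≰⇒> λ s≤r → contradiction (^-monoˡ-≤ k s≤r)
    (<⇒≱ (subst (r ^ k <_) v≡sᵏ (m<m+n (r ^ k) (>-nonZero⁻¹ (2 * w) {{m*n≢0 2 w}}))))

-- Differences of odd powers

-- (s²ᵇ⁺¹ − r²ᵇ⁺¹) / (s − r)
oddQuotient : ℕ → ℕ → ℕ → ℕ
oddQuotient r s zero = 1
oddQuotient r s (suc b) =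
  s ^ suc b * s ^ suc b + r ^ suc b * r ^ suc b + r * s * oddQuotient r s b

-- Writing one factor `s` of `s ^ (3 + b * 2)` as `r + d` splits off `d` times the first square in
-- `oddQuotient`. The induction hypothesis rewrites the rest, and expanding the remaining `s` in
-- front of the power of `r` yields the second square.
odd-power-difference : ∀ r d b →
  (r + d) ^ (1 + b * 2) ≡ r ^ (1 + b * 2) + d * oddQuotient r (r + d) b
odd-power-difference r d zero = base r d
  where
  base : ∀ r d → (r + d) * 1 ≡ r * 1 + d * 1
  base = solve-∀
odd-power-difference r d (suc b) = begin
  s * (s * s ^ (1 + b * 2))                            ≡⟨ cong (λ X → s * (s * X)) (square s) ⟩
  s * (s * (s * (S * S)))                              ≡⟨ split r d S ⟩
  r * s * (s * (S * S)) + d * (s * S * (s * S))        ≡⟨ cong (λ X → r * s * X + d * (s * S * (s * S))) hyp ⟩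
  r * s * (r * (R * R) + d * T) + d * (s * S * (s * S)) ≡⟨ collect r d S R T ⟩
  r * (r * (r * (R * R))) + d * (s * S * (s * S) + r * R * (r * R) + r * s * T)
    ≡⟨ cong (λ X → r * (r * X) + d * (s * S * (s * S) + r * R * (r * R) + r * s * T)) (square r) ⟨
  r * (r * r ^ (1 + b * 2)) + d * (s * S * (s * S) + r * R * (r * R) + r * s * T) ∎
  where
  open ≡-Reasoning
  s = r + d
  S = s ^ b
  R = r ^ b
  T = oddQuotient r s b
  square : ∀ m → m ^ (1 + b * 2) ≡ m * (m ^ b * m ^ b)
  square m = cong (m *_) (trans (^-*2 m b) (cong (m ^ b *_) (*-identityʳ (m ^ b))))
  hyp : s * (S * S) ≡ r * (R * R) + d * T
  hyp = trans (sym (square s)) (trans (odd-power-difference r d b) (cong (_+ d * T) (square r)))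
  split : ∀ r d S → (r + d) * ((r + d) * ((r + d) * (S * S))) ≡
    r * (r + d) * ((r + d) * (S * S)) + d * ((r + d) * S * ((r + d) * S))
  split = solve-∀
  collect : ∀ r d S R T → r * (r + d) * (r * (R * R) + d * T) + d * ((r + d) * S * ((r + d) * S)) ≡
    r * (r * (r * (R * R))) + d * ((r + d) * S * ((r + d) * S) + r * R * (r * R) + r * (r + d) * T)
  collect = solve-∀

m≤n⇒2mn≤n²+m² : ∀ {m n} → m ≤ n → 2 * (m * n) ≤ n * n + m * m
m≤n⇒2mn≤n²+m² {m} m≤n with m≤n⇒∃[o]m+o≡n m≤n
... | o , refl = subst (2 * (m * (m + o)) ≤_) (sym (expand m o)) (m≤m+n _ (o * o))
  where
  expand : ∀ m o → (m + o) * (m + o) + m * m ≡ 2 * (m * (m + o)) + o * o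
  expand = solve-∀

-- By AM-GM the two outer squares contribute at least `2 * (r * s) ^ suc b`, and the inner term
-- contributes `1 + b * 2` further copies by induction.
oddQuotient-lower-bound : ∀ {r s} b → r ≤ s → (1 + b * 2) * (r * s) ^ b ≤ oddQuotient r s b
oddQuotient-lower-bound zero r≤s = ≤-refl
oddQuotient-lower-bound {r} {s} (suc b) r≤s = begin
  (3 + b * 2) * (r * s * (r * s) ^ b)
    ≡⟨ expand (b * 2) (r * s) ((r * s) ^ b) ⟩
  2 * (r * s) ^ suc b + r * s * ((1 + b * 2) * (r * s) ^ b)
    ≡⟨ cong (λ X → 2 * X + r * s * ((1 + b * 2) * (r * s) ^ b)) (^-distribʳ-* r s (suc b)) ⟩
  2 * (r ^ suc b * s ^ suc b) + r * s * ((1 + b * 2) * (r * s) ^ b)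
    ≤⟨ +-mono-≤ (m≤n⇒2mn≤n²+m² (^-monoˡ-≤ (suc b) r≤s)) (*-monoʳ-≤ (r * s) (oddQuotient-lower-bound b r≤s)) ⟩
  oddQuotient r s (suc b) ∎
  where
  open ≤-Reasoning
  expand : ∀ c n N → (3 + c) * (n * N) ≡ 2 * (n * N) + n * ((1 + c) * N)
  expand = solve-∀

-- Primes

prime∤⇒coprime : ∀ {p n} → Prime p → ¬ p ∣ n → Coprime p n
prime∤⇒coprime pp p∤n (d∣p , d∣n) with prime⇒irreducible pp d∣p
... | inj₁ d≡1 = d≡1
... | inj₂ refl = contradiction d∣n p∤n

∣prime^⇒≡1⊎∣ : ∀ {p e} k → Prime p → e ∣ p ^ k → e ≡ 1 ⊎ p ∣ e
∣prime^⇒≡1⊎∣ {p} {e} k pp e∣pᵏ with p ∣? e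
... | yes p∣e = inj₂ p∣e
... | no p∤e = inj₁ (coprime-^ˡ k (prime∤⇒coprime pp p∤e) (e∣pᵏ , ∣-refl))

prime-factorisation-< : ∀ {p r s} → Prime p → r * s ≡ p → r < s → r ≡ 1 × s ≡ p
prime-factorisation-< {p} {r} {s} pp rs≡p r<s with prime⇒irreducible pp (divides r (sym rs≡p))
... | inj₂ refl = m*n≡n⇒m≡1 r s rs≡p , refl
  where
  m*n≡n⇒m≡1 : ∀ m n .{{_ : NonZero n}} → m * n ≡ n → m ≡ 1
  m*n≡n⇒m≡1 m n eq = *-cancelʳ-≡ m 1 n (trans eq (sym (*-identityˡ n)))
  instance
    _ = prime⇒nonZero pp
-- If `s = 1`, then `r < s` forces `r = 0` and hence `p = 0`.
... | inj₁ refl with s≤s z≤n ← r<s = contradiction (subst Prime (sym rs≡p) pp) ¬prime[0]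

odd-prime∣3 : ∀ {p} → Prime p → ¬ 2 ∣ p → p ∣ 3 → p ≡ 3
odd-prime∣3 {0} pp _ _ = contradiction pp ¬prime[0]
odd-prime∣3 {1} pp _ _ = contradiction pp ¬prime[1]
odd-prime∣3 {2} _ 2∤2 _ = contradiction ∣-refl 2∤2
odd-prime∣3 {3} _ _ _ = refl
odd-prime∣3 {suc (suc (suc (suc _)))} _ _ p∣3 with s≤s (s≤s (s≤s ())) ← ∣⇒≤ p∣3

-- The case x odd

-- Used with `n = 2` and `k = p`, where it says that powers of `2 * p + 1` are 1 modulo `p`.
1+kn^m≡1+n* : ∀ k n m → ∃[ t ] (n * k + 1) ^ m ≡ 1 + k * t
1+kn^m≡1+n* k n zero = 0 , cong suc (sym (*-zeroʳ k))
1+kn^m≡1+n* k n (suc m) with 1+kn^m≡1+n* k n m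
... | t , eq = n + n * k * t + t , trans (cong ((n * k + 1) *_) eq) (expand k n t)
  where
  expand : ∀ k n t → (n * k + 1) * (1 + k * t) ≡ 1 + k * (n + n * k * t + t)
  expand = solve-∀

-- Raising the exponent by two multiplies by 9, which is 2 modulo 7, and doubling permutes 3, 6, 5
-- cyclically. These are the quadratic non-residues, so 1 never occurs.
3^odd-mod-7 : ∀ c → let i = 3 ^ (1 + c * 2) % 7 in i ≡ 3 ⊎ i ≡ 6 ⊎ i ≡ 5
3^odd-mod-7 zero = inj₁ refl
3^odd-mod-7 (suc c) with 3^odd-mod-7 c | times-9
  where
  times-9 : 3 ^ (3 + c * 2) % 7 ≡ 2 * (3 ^ (1 + c * 2) % 7) % 7
  times-9 = trans (cong (_% 7) (sym (*-assoc 3 3 (3 ^ (1 + c * 2)))))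
                  (%-distribˡ-* 9 (3 ^ (1 + c * 2)) 7)
... | inj₁ i≡3 | eq = inj₂ (inj₁ (trans eq (cong (λ i → 2 * i % 7) i≡3)))
... | inj₂ (inj₁ i≡6) | eq = inj₂ (inj₂ (trans eq (cong (λ i → 2 * i % 7) i≡6)))
... | inj₂ (inj₂ i≡5) | eq = inj₁ (trans eq (cong (λ i → 2 * i % 7) i≡5))

-- Here 7 is `2 * p + 1` at `p = 3`. Its exponent is positive, so the right-hand side is 1 modulo 7.
3^odd≢1+2*7^ : ∀ a b → ¬ 3 ^ (1 + a * 2) ≡ 1 + 2 * 7 ^ suc b
3^odd≢1+2*7^ a b eq with 3^odd-mod-7 a | mod-7
  where
  mod-7 : 3 ^ (1 + a * 2) % 7 ≡ 1
  mod-7 = trans (cong (_% 7) (trans eq (cong suc (rearrange (7 ^ b))))) ([m+kn]%n≡m%n 1 (2 * 7 ^ b) 7)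
    where
    rearrange : ∀ X → 2 * (7 * X) ≡ 2 * X * 7
    rearrange = solve-∀
... | inj₁ i≡3 | i≡1 with () ← trans (sym i≡3) i≡1
... | inj₂ (inj₁ i≡6) | i≡1 with () ← trans (sym i≡6) i≡1
... | inj₂ (inj₂ i≡5) | i≡1 with () ← trans (sym i≡5) i≡1

coprime-m*n+1ʳ : ∀ m n → Coprime (m * n + 1) n
coprime-m*n+1ʳ m n (d∣mn+1 , d∣n) = ∣1⇒≡1 (∣m+n∣m⇒∣n d∣mn+1 (∣n⇒∣m*n m d∣n))

coprime-m*n+1ˡ : ∀ m n → Coprime (m * n + 1) m
coprime-m*n+1ˡ m n (d∣mn+1 , d∣m) = ∣1⇒≡1 (∣m+n∣m⇒∣n d∣mn+1 (∣m⇒∣m*n n d∣m))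

2m+1≢0 : ∀ m → NonZero (2 * m + 1)
2m+1≢0 m = >-nonZero (m≤n+m 1 (2 * m))

no-solution-x-odd : ∀ {p z} a b → Prime p → ¬ 2 ∣ p →
  ¬ p ^ (1 + a * 2) + (2 * p + 1) ^ (suc b * 2) ≡ z ^ 2
no-solution-x-odd {p} {z} a b pp 2∤p eq
  -- The square is that of `w = (2 * p + 1) ^ suc b`, and the power to be split is `p ^ x`.
  with power-as-difference-of-squares {(2 * p + 1) ^ suc b} {p} {z} (1 + a * 2) {{_}} {{prime⇒nonZero pp}} {{m^n≢0 (2 * p + 1) (suc b) {{2m+1≢0 p}}}}
         (coprime-* (prime∤⇒coprime pp p∤2) (coprime-^ʳ (suc b) (coprime-sym (coprime-m*n+1ʳ 2 p))))
         (trans (cong (_+ p ^ (1 + a * 2)) (sym (^-*2 (2 * p + 1) (suc b)))) (trans (+-comm _ (p ^ (1 + a * 2))) eq))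
  where
  p∤2 : ¬ p ∣ 2
  p∤2 p∣2 with irreducible[2] p∣2
  ... | inj₁ refl = ¬prime[1] pp
  ... | inj₂ refl = 2∤p ∣-refl
... | r , s , rs≡p , r<s , _ , diff with prime-factorisation-< pp rs≡p r<s
... | refl , refl with odd-prime∣3 pp 2∤p p∣3
  where
  pˣ≡ : p ^ (1 + a * 2) ≡ 1 + 2 * (2 * p + 1) ^ suc b
  pˣ≡ = trans diff (cong (_+ 2 * (2 * p + 1) ^ suc b) (^-zeroˡ (1 + a * 2)))
  p∣3 : p ∣ 3
  p∣3 with 1+kn^m≡1+n* p 2 (suc b)
  ... | t , qᵐ≡ = ∣m+n∣m⇒∣n {n = 3} (subst (p ∣_) pˣ≡pt+3 (m∣m*n (p ^ (a * 2)))) (m∣m*n (2 * t))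
    where
    expand : ∀ p t → 1 + 2 * (1 + p * t) ≡ p * (2 * t) + 3
    expand = solve-∀
    pˣ≡pt+3 : p ^ (1 + a * 2) ≡ p * (2 * t) + 3
    pˣ≡pt+3 = trans pˣ≡ (trans (cong (λ X → 1 + 2 * X) qᵐ≡) (expand p t))
... | refl = 3^odd≢1+2*7^ a b (trans diff (cong (_+ 2 * 7 ^ suc b) (^-zeroˡ (1 + a * 2))))

-- The case x even

-- Weakening `r * s` to `2 * p` isolates a factor `p ^ b`, which can then be cancelled against
-- `p ^ a ≤ p ^ suc b`.
oddQuotient-prime-bound : ∀ {p r s} b → r * s ≡ 2 * p + 1 → r ≤ s →
  (1 + b * 2) * 2 ^ b * p ^ b ≤ oddQuotient r s b
oddQuotient-prime-bound {p} {r} {s} b rs≡q r≤s = begin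
  (1 + b * 2) * 2 ^ b * p ^ b      ≡⟨ *-assoc (1 + b * 2) (2 ^ b) (p ^ b) ⟩
  (1 + b * 2) * (2 ^ b * p ^ b)    ≡⟨ cong ((1 + b * 2) *_) (^-distribʳ-* 2 p b) ⟨
  (1 + b * 2) * (2 * p) ^ b        ≤⟨ *-monoʳ-≤ (1 + b * 2) (^-monoˡ-≤ b 2p≤rs) ⟩
  (1 + b * 2) * (r * s) ^ b        ≤⟨ oddQuotient-lower-bound b r≤s ⟩
  oddQuotient r s b                ∎
  where
  open ≤-Reasoning
  2p≤rs : 2 * p ≤ r * s
  2p≤rs = subst (2 * p ≤_) (sym rs≡q) (m≤m+n (2 * p) 1)

[1+2b]2ᵇ≤1⇒b≡0 : ∀ b → (1 + b * 2) * 2 ^ b ≤ 1 → b ≡ 0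
[1+2b]2ᵇ≤1⇒b≡0 zero _ = refl
[1+2b]2ᵇ≤1⇒b≡0 (suc b) le
  with s≤s () ← ≤-trans (m≤m*n (3 + b * 2) (2 ^ suc b) {{m^n≢0 2 (suc b)}}) le

-- p ≢ (2b+1)2ᵇ because the right-hand side is 1 or even.
odd-prime-strict-bound : ∀ {p} b → Prime p → ¬ 2 ∣ p →
  (1 + b * 2) * 2 ^ b ≤ p → (1 + b * 2) * 2 ^ b < p
odd-prime-strict-bound zero pp _ le = ≤∧≢⇒< le λ {refl → ¬prime[1] pp}
odd-prime-strict-bound (suc b) _ 2∤p le =
  ≤∧≢⇒< le λ {refl → 2∤p (∣n⇒∣m*n (3 + b * 2) (m∣m*n (2 ^ b)))}

-- It suffices that `2 ^ suc b ≤ n`. For `b = 0` this uses the extra 1 from the strict inequality;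
-- for larger `b` the odd factor is already at least 2.
[1+2b]2ᵇ<n⇒b<⌈log₂n⌉ : ∀ {n} b → (1 + b * 2) * 2 ^ b < n → b < ⌈log₂ n ⌉
[1+2b]2ᵇ<n⇒b<⌈log₂n⌉ {n} b lt =
  subst (_≤ ⌈log₂ n ⌉) (⌈log₂2^n⌉≡n (suc b)) (⌈log₂⌉-mono-≤ (≤-trans (double b) lt))
  where
  double : ∀ b → 2 ^ suc b ≤ suc ((1 + b * 2) * 2 ^ b)
  double zero = ≤-refl
  double (suc b) = m≤n⇒m≤1+n (*-monoˡ-≤ (2 ^ suc b) {2} {3 + b * 2} (s≤s (s≤s z≤n)))

-- The case `e = p`, so that `s = r + p * 2`. With `b = 0` the bounds on `a` leave `a = 1`, and
-- `r * (r + p * 2)` is 0 at `r = 0`, equals `2 * p + 1` at `r = 1` and exceeds it afterwards.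
caseI : ∀ {p r a b z} → 0 < a → a ≤ suc b → b ≡ 0 →
  r * (r + p * 2) ≡ 2 * p + 1 → z ≡ p ^ a + r ^ (1 + b * 2) →
  CaseI p (a * 2) (1 + b * 2) z
caseI {p} {r} {suc zero} _ _ refl rs≡q z≡ = refl , refl ,
  trans z≡ (cong₂ _+_ (*-identityʳ p) (trans (*-identityʳ r) (r≡1 r rs≡q)))
  where
  r≡1 : ∀ r → r * (r + p * 2) ≡ 2 * p + 1 → r ≡ 1
  r≡1 0 eq = contradiction (trans eq (+-comm (2 * p) 1)) λ ()
  r≡1 1 _ = refl
  r≡1 (suc (suc r)) eq = contradiction eq (>⇒≢ (subst (2 * p + 1 <_) (expand r p) (m<m+n (2 * p + 1) z<s)))
    where
    expand : ∀ r p → 2 * p + 1 + suc (2 + r * 4 + r * r + 2 * p + r * p * 2) ≡ (2 + r) * (2 + r + p * 2)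
    expand = solve-∀
caseI {a = suc (suc _)} _ (s≤s ()) refl _ _

-- The case `e = 1`, with `k = suc j`: then `r` and `s` are `2k - 1` and `2k + 1`. For `j = 0` their
-- product is 3, which would make `p = 1`.
caseII : ∀ {p a b j} → Prime p → ¬ 2 ∣ p → 0 < a → a ≤ suc b →
  let r = 1 + j * 2; s = r + 2 in
  r * s ≡ 2 * p + 1 → s ^ (1 + b * 2) ≡ r ^ (1 + b * 2) + 2 * p ^ a →
  oddQuotient r s b ≡ p ^ a →
  CaseII p (a * 2) (1 + b * 2)
caseII {p} {j = zero} pp _ _ _ rs≡q _ _ = contradiction (subst Prime p≡1 pp) ¬prime[1]
  where
  p≡1 : p ≡ 1
  p≡1 = *-cancelˡ-≡ p 1 2 (sym (+-cancelʳ-≡ 1 2 (2 * p) rs≡q))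
caseII {p} {a} {b} {j@(suc _)} pp 2∤p 0<a a≤1+b rs≡q diff T≡pᵃ =
  composite {d = r} r<q (divides s (trans (sym rs≡q) (*-comm r s))) ,
  suc j , a , b , s≤s (s≤s z≤n) , 0<a , z≤n , *-comm a 2 , y≡ , sym P≡p ,
  trans (sym rs≡q) (sym (cong₂ _*_ R≡r S≡s)) ,
  trans (cong₂ gcd R≡r S≡s) (coprime⇒gcd≡1 coprime) ,
  difference ,
  subst₂ (λ n m → n * 2 ^ b < m) y≡ (sym P≡p) bound ,
  subst (λ m → b < ⌈log₂ m ⌉) (sym P≡p) ([1+2b]2ᵇ<n⇒b<⌈log₂n⌉ b bound)
  where
  instance
    _ = prime⇒nonZero pp
  r = 1 + j * 2
  s = r + 2
  r<q : r < 2 * p + 1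
  r<q = <-≤-trans (m<m+n r z<s) (subst (s ≤_) rs≡q (m≤n*m s r))
  y≡ : 1 + b * 2 ≡ 2 * b + 1
  y≡ = trans (+-comm 1 (b * 2)) (cong (_+ 1) (*-comm b 2))
  R≡r : 2 * suc j ∸ 1 ≡ r
  R≡r = cong (_∸ 1) (*-comm 2 (suc j))
  S≡s : 2 * suc j + 1 ≡ s
  S≡s = expand j
    where
    expand : ∀ j → 2 * suc j + 1 ≡ 1 + j * 2 + 2
    expand = solve-∀
  P≡p : 2 * suc j ^ 2 ∸ 1 ≡ p
  P≡p = trans (cong (_∸ 1) 2k²≡p+1) (m+n∸n≡m p 1)
    where
    expand : ∀ j → 2 * (2 * (suc j * (suc j * 1))) ≡ (1 + j * 2) * (1 + j * 2 + 2) + 1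
    expand = solve-∀
    collect : ∀ p → 2 * p + 1 + 1 ≡ 2 * (p + 1)
    collect = solve-∀
    -- Both sides are halves of `r * s + 1`, which is `4k²` and also `2 * p + 2`.
    2k²≡p+1 : 2 * suc j ^ 2 ≡ p + 1
    2k²≡p+1 = *-cancelˡ-≡ _ _ 2 (trans (expand j) (trans (cong (_+ 1) rs≡q) (collect p)))
  coprime : Coprime r s
  -- A common divisor divides `s - r = 2` and the odd number `r * s = 2 * p + 1`.
  coprime {d} (d∣r , d∣s) = coprime-m*n+1ˡ 2 p (subst (d ∣_) rs≡q (∣m⇒∣m*n s d∣r) , ∣m+n∣m⇒∣n d∣s d∣r)
  difference : (2 * suc j + 1) ^ (2 * b + 1) ∸ (2 * suc j ∸ 1) ^ (2 * b + 1) ≡ 2 * (2 * suc j ^ 2 ∸ 1) ^ a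
  difference = begin
    (2 * suc j + 1) ^ (2 * b + 1) ∸ (2 * suc j ∸ 1) ^ (2 * b + 1)
      ≡⟨ cong₂ _∸_ (cong₂ _^_ S≡s (sym y≡)) (cong₂ _^_ R≡r (sym y≡)) ⟩
    s ^ (1 + b * 2) ∸ r ^ (1 + b * 2)                     ≡⟨ cong (_∸ r ^ (1 + b * 2)) diff ⟩
    r ^ (1 + b * 2) + 2 * p ^ a ∸ r ^ (1 + b * 2)         ≡⟨ m+n∸m≡n (r ^ (1 + b * 2)) (2 * p ^ a) ⟩
    2 * p ^ a                                             ≡⟨ cong (λ m → 2 * m ^ a) P≡p ⟨
    2 * (2 * suc j ^ 2 ∸ 1) ^ a                           ∎
    where open ≡-Reasoning
  bound : (1 + b * 2) * 2 ^ b < p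
  -- Cancelling `p ^ b` gives the weak inequality; parity makes it strict.
  bound = odd-prime-strict-bound b pp 2∤p (*-cancelʳ-≤ _ p (p ^ b) {{m^n≢0 p b}} (begin
    (1 + b * 2) * 2 ^ b * p ^ b   ≤⟨ oddQuotient-prime-bound {p} {r} {s} b rs≡q (m≤m+n r 2) ⟩
    oddQuotient r s b             ≡⟨ T≡pᵃ ⟩
    p ^ a                         ≤⟨ ^-monoʳ-≤ p a≤1+b ⟩
    p * p ^ b                     ∎))
    where open ≤-Reasoning

odd-factors : ∀ {r s n} → r * s ≡ 2 * n + 1 → r < s → ∃[ j ] ∃[ e ] (r ≡ 1 + j * 2 × s ≡ r + e * 2)
odd-factors {r} {s} {n} rs≡ r<s with ∣odd⇒odd {n = n} (subst (r ∣_) odd (m∣m*n s)) | ∣odd⇒odd {n = n} (subst (s ∣_) odd (n∣m*n r))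
  where
  odd : r * s ≡ 1 + n * 2
  odd = trans rs≡ (trans (+-comm (2 * n) 1) (cong suc (*-comm 2 n)))
... | j , refl | i , refl with m≤n⇒∃[o]m+o≡n (*-cancelʳ-≤ j i 2 (<⇒≤ (s<s⁻¹ r<s)))
... | e , refl = j , e , refl , cong suc (*-distribʳ-+ 2 j e)

solutions-x-even : ∀ {p z} a b → Prime p → ¬ 2 ∣ p → 0 < a → a ≤ suc b →
  p ^ (a * 2) + (2 * p + 1) ^ (1 + b * 2) ≡ z ^ 2 →
  CaseI p (a * 2) (1 + b * 2) z ⊎ CaseII p (a * 2) (1 + b * 2)
solutions-x-even {p} {z} a b pp 2∤p 0<a a≤1+b eq
  with power-as-difference-of-squares {p ^ a} {2 * p + 1} {z} (1 + b * 2) {{_}} {{2m+1≢0 p}} {{m^n≢0 p a {{prime⇒nonZero pp}}}}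
         (coprime-* (coprime-m*n+1ˡ 2 p) (coprime-^ʳ a (coprime-m*n+1ʳ 2 p)))
         (trans (cong (_+ (2 * p + 1) ^ (1 + b * 2)) (sym (^-*2 p a))) eq)
... | r , s , rs≡q , r<s , z≡ , diff with odd-factors {n = p} rs≡q r<s
... | j , e , refl , refl = split (∣prime^⇒≡1⊎∣ a pp (divides T (trans (sym eT≡pᵃ) (*-comm e T))))
  where
  instance
    _ = prime⇒nonZero pp
  T = oddQuotient r s b
  -- Both `2 * e * T` and `2 * p ^ a` are the excess of `s ^ y` over `r ^ y`.
  eT≡pᵃ : e * T ≡ p ^ a
  eT≡pᵃ = *-cancelˡ-≡ _ _ 2 (+-cancelˡ-≡ (r ^ (1 + b * 2)) _ _
    (trans (cong (r ^ (1 + b * 2) +_) (rearrange e T)) (trans (sym (odd-power-difference r (e * 2) b)) diff)))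
    where
    rearrange : ∀ e T → 2 * (e * T) ≡ e * 2 * T
    rearrange = solve-∀
  p∣e⇒b≡0 : p ∣ e → b ≡ 0
  -- As `e` is nonzero, `p ≤ e`. This extra factor `p` lifts the lower bound for `e * T` to a
  -- multiple of `p ^ suc b`, which already bounds `p ^ a` from above, so `(1 + b * 2) * 2 ^ b ≤ 1`.
  p∣e⇒b≡0 p∣e = [1+2b]2ᵇ≤1⇒b≡0 b (*-cancelʳ-≤ _ 1 (p ^ suc b) {{m^n≢0 p (suc b)}} (begin
    (1 + b * 2) * 2 ^ b * (p * p ^ b)  ≡⟨ rearrange ((1 + b * 2) * 2 ^ b) p (p ^ b) ⟩
    p * ((1 + b * 2) * 2 ^ b * p ^ b)  ≤⟨ *-mono-≤ (∣⇒≤ {{e≢0}} p∣e) (oddQuotient-prime-bound {p} {r} {s} b rs≡q (<⇒≤ r<s)) ⟩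
    e * T                              ≡⟨ eT≡pᵃ ⟩
    p ^ a                              ≤⟨ ^-monoʳ-≤ p a≤1+b ⟩
    p ^ suc b                          ≡⟨ *-identityˡ (p ^ suc b) ⟨
    1 * p ^ suc b                      ∎))
    where
    open ≤-Reasoning
    rearrange : ∀ m p P → m * (p * P) ≡ p * (m * P)
    rearrange = solve-∀
    e≢0 : NonZero e
    e≢0 = m*n≢0⇒m≢0 e {{subst NonZero (sym eT≡pᵃ) (m^n≢0 p a)}}
  b≡0⇒e≡p : b ≡ 0 → e ≡ p
  b≡0⇒e≡p refl = begin
    e      ≡⟨ *-identityʳ e ⟨
    e * 1  ≡⟨ eT≡pᵃ ⟩
    p ^ a  ≡⟨ cong (p ^_) (≤-antisym a≤1+b 0<a) ⟩
    p * 1  ≡⟨ *-identityʳ p ⟩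
    p      ∎
    where open ≡-Reasoning
  split : e ≡ 1 ⊎ p ∣ e → CaseI p (a * 2) (1 + b * 2) z ⊎ CaseII p (a * 2) (1 + b * 2)
  split (inj₁ refl) = inj₂ (caseII {j = j} pp 2∤p 0<a a≤1+b rs≡q diff
    (trans (sym (*-identityˡ T)) eT≡pᵃ))
  split (inj₂ p∣e) = inj₁ (caseI {r = r} 0<a a≤1+b b≡0
    (subst (λ e → r * (r + e * 2) ≡ 2 * p + 1) (b≡0⇒e≡p b≡0) rs≡q) z≡)
    where b≡0 = p∣e⇒b≡0 p∣e

-- Exclusivity of the two cases and the classification

-- For y = 1 the equation of the second case reads 2 = 2pᵃ.
cases-exclusive : ∀ {p x y z} → ¬ (CaseI p x y z × CaseII p x y)
cases-exclusive ((_ , refl , _) , _ , _ , _ , suc b , _ , _ , _ , _ , y≡ , _)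
  with () ← trans y≡ (cong suc (+-comm (b + suc (b + 0)) 1))
-- At `b = 0` the bound of the second case reads `1 < P`, so `P ^ a` exceeds 1.
cases-exclusive ((_ , refl , _) , _ , suc j , a , zero , _ , 0<a , _ , _ , _ , _ , _ , _ , diff , 1<P , _) =
  <⇒≢ (^-monoʳ-< P 1<P 0<a) (sym Pᵃ≡1)
  where
  P = 2 * suc j ^ 2 ∸ 1
  Pᵃ≡1 : P ^ a ≡ 1
  Pᵃ≡1 = *-cancelˡ-≡ _ _ 2 (begin
    2 * P ^ a                                  ≡⟨ diff ⟨
    (2 * suc j + 1) ^ 1 ∸ (2 * suc j ∸ 1) ^ 1  ≡⟨ cong (_∸ (2 * suc j ∸ 1) ^ 1) (expand (j + suc (j + 0))) ⟩
    (2 * suc j ∸ 1) ^ 1 + 2 ∸ (2 * suc j ∸ 1) ^ 1 ≡⟨ m+n∸m≡n ((2 * suc j ∸ 1) ^ 1) 2 ⟩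
    2 ∎)
    where
    open ≡-Reasoning
    expand : ∀ R → (suc R + 1) * 1 ≡ R * 1 + 2
    expand = solve-∀

theorem3p1 : ∀ (p x y z : ℕ) → Prime p → ¬ (2 ∣ p) →
    0 < x → 0 < y → 0 < z →
    ∣ x - y ∣ ≡ 1 →
    p ^ x + (2 * p + 1) ^ y ≡ z ^ 2 →
    ExactlyOneOf (CaseI p x y z) (CaseII p x y)
theorem3p1 p x y z pp 2∤p 0<x 0<y _ ∣x-y∣≡1 eq = solutions , cases-exclusive
  where
  solutions : CaseI p x y z ⊎ CaseII p x y
  solutions with consecutive-parities x y ∣x-y∣≡1
  ... | inj₁ (a , b , refl , refl , a≤1+b) =
    solutions-x-even a b pp 2∤p (*-cancelʳ-< 2 0 a 0<x) a≤1+b eq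
  ... | inj₂ (a , suc b , refl , refl) = contradiction eq (no-solution-x-odd {z = z} a b pp 2∤p)
  ... | inj₂ (a , zero , refl , refl) = contradiction 0<y λ ()
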